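{- Let $K_4^3$ denote the complete $3$-uniform hypergraph on $4$ vertices and let $E_1$ denote the $3$-uniform hypergraph with $4$ vertices and exactly $1$ edge. The number of $3$-uniform hypergraphs on the vertex set $[n]=\{1,\ldots,n\}$ which contain neither $K_4^3$ nor $E_1$ as an induced subhypergraph (equivalently, in which no set of $4$ vertices spans exactly $1$ or exactly $4$ edges) is $2^{\Theta(n^2\log n)}$ as $n\to\infty$.
   Context: A $3$-graph is a $3$-uniform hypergraph. Hypergraphs are counted as labeled hypergraphs on the vertex set $[n]$. Logarithms are in base $2$. -}

module Defs where

open import Data.Nat using (ℕ; zero; suc; _+_; _<ᵇ_; _≡ᵇ_)
open import Data.Bool using (Bool; true; false; _∧_; not; if_then_else_)
open import Data.Fin using (Fin; toℕ; _≟_)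
open import Data.Product using (_×_; _,_)
open import Data.List using (List; []; _∷_; _++_; map; concatMap; allFin; filterᵇ; length)
open import Data.Bool.ListAction using (all; any)
open import Relation.Nullary using (does)

Triple : ℕ → Set
Triple n = Fin n × Fin n × Fin n

Quad : ℕ → Set
Quad n = Fin n × Fin n × Fin n × Fin n

_<F_ : ∀ {n} → Fin n → Fin n → Bool
i <F j = toℕ i <ᵇ toℕ j

triples : (n : ℕ) → List (Triple n)
triples n =
  concatMap (λ i → concatMap (λ j → concatMap (λ k →
    if (i <F j) ∧ (j <F k) then (i , j , k) ∷ [] else []) (allFin n)) (allFin n)) (allFin n)

quads : (n : ℕ) → List (Quad n)
quads n =
  concatMap (λ a → concatMap (λ b → concatMap (λ c → concatMap (λ d →
    if (a <F b) ∧ (b <F c) ∧ (c <F d) then (a , b , c , d) ∷ [] else [])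
    (allFin n)) (allFin n)) (allFin n)) (allFin n)

-- All sublists of a list: for a duplicate-free list these are exactly its
-- subsets, each listed once.
sublists : ∀ {a} {A : Set a} → List A → List (List A)
sublists [] = [] ∷ []
sublists (x ∷ xs) = map (x ∷_) (sublists xs) ++ sublists xs

-- A labeled 3-graph on [n] is a set of 3-subsets of [n], i.e. a sublist of
-- (triples n).  The list of all labeled 3-graphs on [n]:
Hypergraph : ℕ → Set
Hypergraph n = List (Triple n)

all3graphs : (n : ℕ) → List (Hypergraph n)
all3graphs n = sublists (triples n)

eqT : ∀ {n} → Triple n → Triple n → Bool
eqT (i , j , k) (i' , j' , k') = does (i ≟ i') ∧ does (j ≟ j') ∧ does (k ≟ k')

isEdge : ∀ {n} → Hypergraph n → Triple n → Bool
isEdge H t = any (eqT t) H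

b2n : Bool → ℕ
b2n true = 1
b2n false = 0

-- number of edges of H spanned by the 4-set {a,b,c,d} (a<b<c<d)
edgesIn : ∀ {n} → Hypergraph n → Quad n → ℕ
edgesIn H (a , b , c , d) =
  b2n (isEdge H (a , b , c)) + b2n (isEdge H (a , b , d)) +
  b2n (isEdge H (a , c , d)) + b2n (isEdge H (b , c , d))

isGood : ∀ {n} → Hypergraph n → Bool
isGood H = all (λ q → not (edgesIn H q ≡ᵇ 1) ∧ not (edgesIn H q ≡ᵇ 4)) (quads _)

countGood : ℕ → ℕ
countGood n = length (filterᵇ isGood (all3graphs n))

{-# OPTIONS --safe #-}

-- Upper bound.  Let L be the link of a fixed vertex v.  A triple a b c avoiding v that spans 0, 1
-- or 3 edges of L is a non-edge, an edge, a non-edge respectively.  If it spans exactly 2, centred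
-- at b, then it is free; but for fixed b, "v a c and b a c are both non-edges" is an equivalence
-- relation on the neighbours of b in L, because {v,a,d,c} and {b,a,d,c} do not span 1 edge and
-- {v,b,a,c} does not span 4.  So the graph is determined by L together with the map sending
-- (b , a) to a representative of the class of a at b, which leaves at most (2 n)^(n²) graphs.
--
-- Lower bound.  Split the vertices into A < B < C and take all triples of type AAB, BBC, ACC as
-- edges; a 4-set of type AABC, ABBC or ABCC then contains exactly one edge besides its two
-- transversal triples.  So removing any family of transversal triples ABC, no two of which
-- share two vertices, from the set of all of them leaves a good graph.  Partial Latin squares
-- f : A × B → C give such families, and filling them greedily, with at least k admissible symbols
-- at each of k² cells, gives k^(k²) of them for k = ⌊n/5⌋.

module Submission where

open import Defs
open import Data.Nat using (ℕ; zero; suc; _+_; _*_; _^_; _∸_; _≤_; _<_; z≤n; s≤s; _≡ᵇ_; _<?_)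
import Data.Nat.Properties as ℕ
open import Data.Nat.DivMod using (_/_; _%_; m≡m%n+[m/n]*n; m%n<n; m/n*n≤m; /-monoˡ-≤)
open import Data.Nat.Solver using (module +-*-Solver)
open import Data.Bool using (Bool; true; false; _∧_; _∨_; not; T; if_then_else_)
import Data.Bool.Properties as Bool
open import Data.Fin as Fin using (Fin; zero; suc; toℕ; fromℕ<; combine; remQuot; funToFin; finToFun)
import Data.Fin.Properties as Fin
open import Data.Product using (Σ; ∃; _×_; _,_; proj₁; proj₂; uncurry)
open import Data.Sum using (_⊎_; inj₁; inj₂)
open import Data.List using (List; []; _∷_; _++_; concatMap; map; filterᵇ; length; allFin; lookup)
import Data.List.Properties as List
open import Data.List.Membership.Propositional using (_∈_; _∉_; find; lose)
import Data.List.Membership.Propositional.Properties as ∈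
import Data.List.Membership.DecPropositional as Dec∈
open import Data.List.Relation.Unary.Any as Any using (Any; here; there)
import Data.List.Relation.Unary.Any.Properties as Any
open import Data.List.Relation.Unary.All as All using (All; []; _∷_)
import Data.List.Relation.Unary.All.Properties as All
open import Data.List.Relation.Unary.AllPairs as AllPairs using ([]; _∷_)
import Data.List.Relation.Unary.AllPairs.Properties as AllPairs
open import Data.List.Relation.Unary.Unique.Propositional using (Unique)
import Data.List.Relation.Unary.Unique.Propositional.Properties as Unique
open import Relation.Binary.PropositionalEquality
open import Relation.Binary.Definitions using (tri<; tri≈; tri>)
open import Relation.Nullary using (¬_; Dec; yes; no; does; contradiction)
open import Relation.Nullary.Decidable using (T?; _×-dec_; _⊎-dec_; dec-true)
open import Function using (_∘_; id; Equivalence; case_of_)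

-- Booleans and decidable propositions

T⇒true : ∀ {b} → T b → b ≡ true
T⇒true = Equivalence.to Bool.T-≡

true⇒T : ∀ {b} → b ≡ true → T b
true⇒T = Equivalence.from Bool.T-≡

¬T⇒false : ∀ {b} → ¬ T b → b ≡ false
¬T⇒false = Bool.¬-not ∘ (_∘ true⇒T)

T-ext : ∀ {b c} → (T b → T c) → (T c → T b) → b ≡ c
T-ext {false} {false} _ _ = refl
T-ext {false} {true}  _ g = contradiction (g _) id
T-ext {true}  {false} f _ = contradiction (f _) id
T-ext {true}  {true}  _ _ = refl

private variable
  A : Set

does⁺ : (A? : Dec A) → A → T (does A?)
does⁺ A? a = true⇒T (dec-true A? a)

does⁻ : (A? : Dec A) → T (does A?) → A
does⁻ (yes a) _ = a

-- Counting by injections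

lookup-injective : {xs : List A} → Unique xs → ∀ i j → lookup xs i ≡ lookup xs j → i ≡ j
lookup-injective (_ ∷ _)     zero    zero    _ = refl
lookup-injective (x∉xs ∷ _)  zero    (suc j) e = contradiction e (All.lookup x∉xs (∈.∈-lookup j))
lookup-injective (x∉xs ∷ _)  (suc i) zero    e = contradiction (sym e) (All.lookup x∉xs (∈.∈-lookup i))
lookup-injective (_ ∷ xs!)   (suc i) (suc j) e = cong suc (lookup-injective xs! i j e)

length≤-by-injection : ∀ {N} {xs : List A} → Unique xs → (f : A → Fin N) →
  (∀ {x y} → x ∈ xs → y ∈ xs → f x ≡ f y → x ≡ y) → length xs ≤ N
length≤-by-injection {xs = xs} xs! f inj = Fin.injective⇒≤ {f = f ∘ lookup xs}
  (λ {i} {j} e → lookup-injective xs! i j (inj (∈.∈-lookup i) (∈.∈-lookup j) e))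

≤length-by-injection : ∀ {N} {xs : List A} (f : Fin N → A) → (∀ i → f i ∈ xs) →
  (∀ {i j} → f i ≡ f j → i ≡ j) → N ≤ length xs
≤length-by-injection f f∈ inj = Fin.injective⇒≤ {f = λ i → Any.index (f∈ i)}
  (λ {i} {j} e → inj (index-injective (f∈ i) (f∈ j) e))
  where
  index-injective : ∀ {x y : A} {xs} (p : x ∈ xs) (q : y ∈ xs) → Any.index p ≡ Any.index q → x ≡ y
  index-injective (here p)  (here q)  _ = trans p (sym q)
  index-injective (there p) (there q) e = index-injective p q (Fin.suc-injective e)

funToFin-injective : ∀ {m n} (f g : Fin m → Fin n) → funToFin f ≡ funToFin g → ∀ i → f i ≡ g i
funToFin-injective f g e i = begin
  f i                      ≡⟨ Fin.finToFun-funToFin f i ⟨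
  finToFun (funToFin f) i  ≡⟨ cong (λ c → finToFun c i) e ⟩
  finToFun (funToFin g) i  ≡⟨ Fin.finToFun-funToFin g i ⟩
  g i                      ∎
  where open ≡-Reasoning

finToFun-injective : ∀ {m n} (c d : Fin (m ^ n)) → (∀ i → finToFun {m} {n} c i ≡ finToFun d i) → c ≡ d
finToFun-injective {m} {n} c d e = begin
  c                              ≡⟨ Fin.funToFin-finToFin {n} {m} c ⟨
  funToFin (finToFun {m} {n} c)  ≡⟨ funToFin-cong e ⟩
  funToFin (finToFun {m} {n} d)  ≡⟨ Fin.funToFin-finToFin {n} {m} d ⟩
  d                              ∎
  where
  open ≡-Reasoning
  funToFin-cong : ∀ {k l} {f g : Fin k → Fin l} → (∀ i → f i ≡ g i) → funToFin f ≡ funToFin g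
  funToFin-cong {zero}  f≗g = refl
  funToFin-cong {suc k} f≗g = cong₂ combine (f≗g zero) (funToFin-cong (f≗g ∘ suc))

-- Sublists of duplicate-free lists

∈-sublist⇒∈ : ∀ {x : A} {xs ys} → ys ∈ sublists xs → x ∈ ys → x ∈ xs
∈-sublist⇒∈ {xs = []}     (here refl) ()
∈-sublist⇒∈ {xs = z ∷ xs} p q with ∈.∈-++⁻ (map (z ∷_) (sublists xs)) p
... | inj₂ p′ = there (∈-sublist⇒∈ p′ q)
... | inj₁ p′ with ∈.∈-map⁻ (z ∷_) p′ | q
...   | _ , _ , refl   | here e   = here e
...   | _ , ys∈ , refl | there q′ = there (∈-sublist⇒∈ ys∈ q′)

sublists-unique : {xs : List A} → Unique xs → Unique (sublists xs)
sublists-unique []           = [] ∷ []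
sublists-unique (x∉xs ∷ xs!) = Unique.++⁺
  (Unique.map⁺ List.∷-injectiveʳ (sublists-unique xs!)) (sublists-unique xs!)
  λ { (p , q) → case ∈.∈-map⁻ _ p of λ { (_ , _ , refl) →
      contradiction refl (All.lookup x∉xs (∈-sublist⇒∈ q (here refl))) } }

-- A graph is a list, so having the same edges must be turned into equality of lists. If only one of
-- the two sublists takes the head `x`, the other must contain `x` from the tail, which uniqueness
-- forbids; so both make the same choice at every element.
sublists-extensional : {xs ys zs : List A} → Unique xs → ys ∈ sublists xs → zs ∈ sublists xs →
  (∀ {x} → x ∈ xs → (x ∈ ys → x ∈ zs) × (x ∈ zs → x ∈ ys)) → ys ≡ zs
sublists-extensional {xs = []} _ (here refl) (here refl) _ = refl
sublists-extensional {xs = x ∷ xs} (x∉xs ∷ xs!) p q same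
  with ∈.∈-++⁻ (map (x ∷_) (sublists xs)) p | ∈.∈-++⁻ (map (x ∷_) (sublists xs)) q
... | inj₂ p′ | inj₂ q′ = sublists-extensional xs! p′ q′ (same ∘ there)
... | inj₁ p′ | inj₂ q′ with ∈.∈-map⁻ (x ∷_) p′
...   | _ , _ , refl = contradiction refl
        (All.lookup x∉xs (∈-sublist⇒∈ q′ (proj₁ (same (here refl)) (here refl))))
sublists-extensional {xs = x ∷ xs} (x∉xs ∷ xs!) p q same
    | inj₂ p′ | inj₁ q′ with ∈.∈-map⁻ (x ∷_) q′
...   | _ , _ , refl = contradiction refl
        (All.lookup x∉xs (∈-sublist⇒∈ p′ (proj₂ (same (here refl)) (here refl))))
sublists-extensional {xs = x ∷ xs} (x∉xs ∷ xs!) p q same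
    | inj₁ p′ | inj₁ q′ with ∈.∈-map⁻ (x ∷_) p′ | ∈.∈-map⁻ (x ∷_) q′
...   | _ , ys∈ , refl | _ , zs∈ , refl = cong (x ∷_) (sublists-extensional xs! ys∈ zs∈ λ y∈ →
        drop y∈ ∘ proj₁ (same (there y∈)) ∘ there , drop y∈ ∘ proj₂ (same (there y∈)) ∘ there)
  where
  drop : ∀ {y zs} → y ∈ xs → y ∈ x ∷ zs → y ∈ zs
  drop y∈ (here refl) = contradiction refl (All.lookup x∉xs y∈)
  drop y∈ (there y∈′) = y∈′

filter∈sublists : (p : A → Bool) (xs : List A) → filterᵇ p xs ∈ sublists xs
filter∈sublists p []       = here refl
filter∈sublists p (x ∷ xs) with p x
... | true  = ∈.∈-++⁺ˡ (∈.∈-map⁺ (x ∷_) (filter∈sublists p xs))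
... | false = ∈.∈-++⁺ʳ _ (filter∈sublists p xs)

-- Sorted triples and quadruples

∈-concatMap-allFin⁺ : ∀ {n} {f : Fin n → List A} {y} i → y ∈ f i → y ∈ concatMap f (allFin n)
∈-concatMap-allFin⁺ i y∈ = ∈.∈-concatMap⁺ _ (lose (∈.∈-allFin i) y∈)

∈-concatMap-allFin⁻ : ∀ {n} (f : Fin n → List A) {y} → y ∈ concatMap f (allFin n) → ∃ λ i → y ∈ f i
∈-concatMap-allFin⁻ f y∈ = case find (∈.∈-concatMap⁻ f {xs = allFin _} y∈) of λ { (i , _ , p) → i , p }

∈-if⁺ : ∀ {b} {y : A} → T b → y ∈ (if b then y ∷ [] else [])
∈-if⁺ {b = true} _ = here refl

∈-if⁻ : ∀ {b} {x y : A} → y ∈ (if b then x ∷ [] else []) → T b × y ≡ x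
∈-if⁻ {b = true} (here e) = _ , e

T-∧⁺ : ∀ {b c} → T b → T c → T (b ∧ c)
T-∧⁺ p q = Equivalence.from Bool.T-∧ (p , q)

Sorted : ∀ {n} → Triple n → Set
Sorted (i , j , k) = i Fin.< j × j Fin.< k

∈-triples⁺ : ∀ {n} {t : Triple n} → Sorted t → t ∈ triples n
∈-triples⁺ {t = i , j , k} (i<j , j<k) =
  ∈-concatMap-allFin⁺ i (∈-concatMap-allFin⁺ j (∈-concatMap-allFin⁺ k
    (∈-if⁺ (T-∧⁺ (ℕ.<⇒<ᵇ i<j) (ℕ.<⇒<ᵇ j<k)))))

-- The inner loops of `triples`, named so that at each level a coordinate of the triple recovers the
-- loop index.
triplesFrom₂ : ∀ {n} → Fin n → Fin n → List (Triple n)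
triplesFrom₂ i j = concatMap (λ k → if (i <F j) ∧ (j <F k) then (i , j , k) ∷ [] else []) (allFin _)

triplesFrom₁ : ∀ {n} → Fin n → List (Triple n)
triplesFrom₁ i = concatMap (triplesFrom₂ i) (allFin _)

∈-triplesFrom₂⁻ : ∀ {n} (i j : Fin n) {t} → t ∈ triplesFrom₂ i j →
  Sorted t × proj₁ t ≡ i × proj₁ (proj₂ t) ≡ j
∈-triplesFrom₂⁻ i j p
  with k , p ← ∈-concatMap-allFin⁻ (λ k → if (i <F j) ∧ (j <F k) then (i , j , k) ∷ [] else []) p
  with c , refl ← ∈-if⁻ {b = (i <F j) ∧ (j <F k)} p
  with i<j , j<k ← Equivalence.to Bool.T-∧ c = (ℕ.<ᵇ⇒< _ _ i<j , ℕ.<ᵇ⇒< _ _ j<k) , refl , refl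

∈-triplesFrom₁⁻ : ∀ {n} (i : Fin n) {t} → t ∈ triplesFrom₁ i → Sorted t × proj₁ t ≡ i
∈-triplesFrom₁⁻ i p
  with j , p ← ∈-concatMap-allFin⁻ (triplesFrom₂ i) p
  with s , e , _ ← ∈-triplesFrom₂⁻ i j p = s , e

∈-triples⁻ : ∀ {n} {t : Triple n} → t ∈ triples n → Sorted t
∈-triples⁻ p with i , p ← ∈-concatMap-allFin⁻ triplesFrom₁ p = proj₁ (∈-triplesFrom₁⁻ i p)

∈-quads⁺ : ∀ {n} {a b c d : Fin n} → a Fin.< b → b Fin.< c → c Fin.< d → (a , b , c , d) ∈ quads n
∈-quads⁺ {a = a} {b} {c} {d} a<b b<c c<d =
  ∈-concatMap-allFin⁺ a (∈-concatMap-allFin⁺ b (∈-concatMap-allFin⁺ c (∈-concatMap-allFin⁺ d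
    (∈-if⁺ (T-∧⁺ (ℕ.<⇒<ᵇ a<b) (T-∧⁺ (ℕ.<⇒<ᵇ b<c) (ℕ.<⇒<ᵇ c<d)))))))

∈-quads⁻ : ∀ {n} {a b c d : Fin n} → (a , b , c , d) ∈ quads n →
  a Fin.< b × b Fin.< c × c Fin.< d
∈-quads⁻ p
  with a , p ← ∈-concatMap-allFin⁻ _ p
  with b , p ← ∈-concatMap-allFin⁻ _ p
  with c , p ← ∈-concatMap-allFin⁻ _ p
  with d , p ← ∈-concatMap-allFin⁻ (λ d → if (a <F b) ∧ (b <F c) ∧ (c <F d) then (a , b , c , d) ∷ [] else []) p
  with q , refl ← ∈-if⁻ {b = (a <F b) ∧ (b <F c) ∧ (c <F d)} p
  with a<b , q ← Equivalence.to Bool.T-∧ q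
  with b<c , c<d ← Equivalence.to Bool.T-∧ q
  = ℕ.<ᵇ⇒< _ _ a<b , ℕ.<ᵇ⇒< _ _ b<c , ℕ.<ᵇ⇒< _ _ c<d

-- Different blocks are disjoint because `key` reads the index of its block off an element.
concatMap-allFin-unique : ∀ {n} (f : Fin n → List A) (key : A → Fin n) → (∀ i → Unique (f i)) →
  (∀ i {y} → y ∈ f i → key y ≡ i) → Unique (concatMap f (allFin n))
concatMap-allFin-unique {n = n} f key f! k = Unique.concat⁺
  (All.map⁺ (All.tabulate λ {i} _ → f! i))
  (AllPairs.map⁺ (AllPairs.map (λ i≢j {y} (p , q) → i≢j (trans (sym (k _ p)) (k _ q))) (Unique.allFin⁺ n)))

if-unique : ∀ b {x : A} → Unique (if b then x ∷ [] else [])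
if-unique true  = [] ∷ []
if-unique false = []

triples-unique : ∀ n → Unique (triples n)
triples-unique n =
  concatMap-allFin-unique triplesFrom₁ proj₁
    (λ i → concatMap-allFin-unique (triplesFrom₂ i) (proj₁ ∘ proj₂)
      (λ j → concatMap-allFin-unique _ (proj₂ ∘ proj₂)
        (λ k → if-unique ((i <F j) ∧ (j <F k)))
        (λ k p → cong (proj₂ ∘ proj₂) (proj₂ (∈-if⁻ {b = (i <F j) ∧ (j <F k)} p))))
      (λ j p → proj₂ (proj₂ (∈-triplesFrom₂⁻ i j p))))
    (λ i p → proj₂ (∈-triplesFrom₁⁻ i p))

-- Edges and good 4-sets

isEdge⁺ : ∀ {n} {H : Hypergraph n} {t} → t ∈ H → T (isEdge H t)
isEdge⁺ {t = i , j , k} = Any.any⁺ _ ∘ Any.map λ { refl →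
  T-∧⁺ (does⁺ (i Fin.≟ i) refl) (T-∧⁺ (does⁺ (j Fin.≟ j) refl) (does⁺ (k Fin.≟ k) refl)) }

isEdge⁻ : ∀ {n} {H : Hypergraph n} {t} → T (isEdge H t) → t ∈ H
isEdge⁻ {H = H} {i , j , k} = Any.map (λ p →
    let p₁ , q = Equivalence.to (Bool.T-∧ {does (i Fin.≟ _)}) p
        p₂ , p₃ = Equivalence.to (Bool.T-∧ {does (j Fin.≟ _)}) q
    in cong₂ _,_ (does⁻ (i Fin.≟ _) p₁) (cong₂ _,_ (does⁻ (j Fin.≟ _) p₂) (does⁻ (k Fin.≟ _) p₃)))
  ∘ Any.any⁻ _ H

-- Stated on four bits, so that once the bits are known it reduces to the unit or the empty type.
Good₄ : Bool → Bool → Bool → Bool → Set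
Good₄ w x y z = T (not (s ≡ᵇ 1) ∧ not (s ≡ᵇ 4))
  where s = b2n w + b2n x + b2n y + b2n z

GoodQuad : ∀ {n} → Hypergraph n → (a b c d : Fin n) → Set
GoodQuad H a b c d =
  Good₄ (isEdge H (a , b , c)) (isEdge H (a , b , d)) (isEdge H (a , c , d)) (isEdge H (b , c , d))

isGood⁻ : ∀ {n} {H : Hypergraph n} → T (isGood H) → ∀ {a b c d} →
  a Fin.< b → b Fin.< c → c Fin.< d → GoodQuad H a b c d
isGood⁻ good a<b b<c c<d = All.lookup (All.all⁺ _ (quads _) good) (∈-quads⁺ a<b b<c c<d)

isGood⁺ : ∀ {n} {H : Hypergraph n} →
  (∀ {a b c d} → a Fin.< b → b Fin.< c → c Fin.< d → GoodQuad H a b c d) →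
  T (isGood H)
isGood⁺ good = All.all⁻ _ (All.tabulate λ q∈ →
  let a<b , b<c , c<d = ∈-quads⁻ q∈ in good a<b b<c c<d)

good-unique : ∀ n → Unique (filterᵇ isGood (all3graphs n))
good-unique n = Unique.filter⁺ _ (sublists-unique (triples-unique n))

-- The upper bound

-- A good 3-graph as a symmetric function of three vertices. The link argument treats all vertices
-- alike and would otherwise need a case for every relative order.
record GoodSystem (n : ℕ) : Set where
  field
    E        : Fin n → Fin n → Fin n → Bool
    swap₁    : ∀ a b c → E a b c ≡ E b a c
    swap₂    : ∀ a b c → E a b c ≡ E a c b
    loopless : ∀ a c → E a a c ≡ false
    good     : ∀ {a b c d} → a ≢ b → a ≢ c → b ≢ c → a ≢ d → b ≢ d → c ≢ d →
               Good₄ (E a b c) (E a b d) (E a c d) (E b c d)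

  true⇒≢₁₂ : ∀ {a b c} → E a b c ≡ true → a ≢ b
  true⇒≢₁₂ {a} {_} {c} e refl = case trans (sym e) (loopless a c) of λ ()

  true⇒≢₂₃ : ∀ {a b c} → E a b c ≡ true → b ≢ c
  true⇒≢₂₃ {a} {b} {c} e = true⇒≢₁₂ (trans (sym (trans (swap₁ a b c) (swap₂ b a c))) e)

  true⇒≢₁₃ : ∀ {a b c} → E a b c ≡ true → a ≢ c
  true⇒≢₁₃ {a} {b} {c} e = true⇒≢₁₂ (trans (sym (swap₂ a b c)) e)

-- If v b a and v b c are edges and v a c is not, the link of v does not decide b a c; then
-- b a c is a non-edge exactly when a and c are twins.
Twin : ∀ {n} (E : Fin n → Fin n → Fin n → Bool) → Fin n → Fin n → Fin n → Fin n → Set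
Twin E v b a c = a ≡ c ⊎ (E v b a ≡ true × E v b c ≡ true × E v a c ≡ false × E b a c ≡ false)

twin? : ∀ {n} (E : Fin n → Fin n → Fin n → Bool) v b a c → Dec (Twin E v b a c)
twin? E v b a c = (a Fin.≟ c) ⊎-dec ((E v b a Bool.≟ true) ×-dec (E v b c Bool.≟ true)
  ×-dec (E v a c Bool.≟ false) ×-dec (E b a c Bool.≟ false))

module _ {n : ℕ} (G : GoodSystem n) where
  open GoodSystem G

  twin-sym : ∀ {v b a c} → Twin E v b a c → Twin E v b c a
  twin-sym (inj₁ e) = inj₁ (sym e)
  twin-sym (inj₂ (p , q , r , s)) =
    inj₂ (q , p , trans (swap₂ _ _ _) r , trans (swap₂ _ _ _) s)

  -- For distinct `a`, `d`, `c`, the sets {v,a,d,c} and {b,a,d,c} each have two known non-edges, so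
  -- `q₁` gives `E v a c` = `E a d c` and `q₂` gives `E b a c` = `E a d c`. Hence `E v a c` =
  -- `E b a c`, and `q₃` excludes that both are true, since {v,b,a,c} would then span 4 edges.
  twin-trans : ∀ {v b a d c} → Twin E v b a d → Twin E v b d c → Twin E v b a c
  twin-trans (inj₁ refl) q = q
  twin-trans p (inj₁ refl) = p
  twin-trans {v} {b} {a} {d} {c} (inj₂ (vba , vbd , vad , bad)) (inj₂ (_ , vbc , vdc , bdc))
    with a Fin.≟ c | a Fin.≟ d | d Fin.≟ c
  ... | yes e | _        | _        = inj₁ e
  ... | no _  | yes refl | _        = inj₂ (vba , vbc , vdc , bdc)
  ... | no _  | no _     | yes refl = inj₂ (vba , vbc , vad , bad)
  ... | no a≢c | no a≢d  | no d≢c   = inj₂ (vba , vbc , decide _ _ _ q₁ q₂ q₃)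
    where
    q₁ : Good₄ false (E v a c) false (E a d c)
    q₁ = subst₂ (λ x y → Good₄ x (E v a c) y (E a d c)) vad vdc
      (good (true⇒≢₁₃ vba) (true⇒≢₁₃ vbd) a≢d (true⇒≢₁₃ vbc) a≢c d≢c)
    q₂ : Good₄ false (E b a c) false (E a d c)
    q₂ = subst₂ (λ x y → Good₄ x (E b a c) y (E a d c)) bad bdc
      (good (true⇒≢₂₃ vba) (true⇒≢₂₃ vbd) a≢d (true⇒≢₂₃ vbc) a≢c d≢c)
    q₃ : Good₄ true true (E v a c) (E b a c)
    q₃ = subst₂ (λ x y → Good₄ x y (E v a c) (E b a c)) vba vbc
      (good (true⇒≢₁₂ vba) (true⇒≢₁₃ vba) (true⇒≢₂₃ vba) (true⇒≢₁₃ vbc) (true⇒≢₂₃ vbc) a≢c)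
    decide : ∀ x y z → Good₄ false x false y → Good₄ false z false y → Good₄ true true x z →
      x ≡ false × z ≡ false
    decide false _     false _ _ _ = refl , refl
    decide false false true  _ () _
    decide false true  true  () _ _
    decide true  true  true  _ _ ()
    decide true  false _     () _ _
    decide true  true  false _ () _

-- Representatives of twin classes

-- The last index is the default: it is returned untested when no earlier one satisfies `p`.
least : ∀ {n} → (Fin (suc n) → Bool) → Fin (suc n)
least {zero}  p = zero
least {suc n} p = if p zero then zero else suc (least (p ∘ suc))

least-satisfies : ∀ {n} (p : Fin (suc n) → Bool) i → T (p i) → T (p (least p))
least-satisfies {zero}  p zero pi = pi
least-satisfies {suc n} p i    pi with p zero in eq
... | true = true⇒T eq
least-satisfies {suc n} p zero    pi | false = contradiction (trans (sym eq) (T⇒true pi)) λ ()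
least-satisfies {suc n} p (suc i) pi | false = least-satisfies (p ∘ suc) i pi

least-cong : ∀ {n} {p q : Fin (suc n) → Bool} → (∀ i → p i ≡ q i) → least p ≡ least q
least-cong {zero}  e = refl
least-cong {suc n} {p} {q} e rewrite e zero =
  cong (if q zero then zero else_) (cong suc (least-cong (e ∘ suc)))

twinRep : ∀ {n} (E : (a b c : Fin (suc n)) → Bool) → (v b a : Fin (suc n)) → Fin (suc n)
twinRep E v b a = least (λ c → does (twin? E v b a c))

module _ {n : ℕ} (G : GoodSystem (suc n)) where
  open GoodSystem G

  -- Twins have the same class, hence the same indicator function to search for its least element.
  twinRep-cong : ∀ {v b a c} → Twin E v b a c → twinRep E v b a ≡ twinRep E v b c
  twinRep-cong {v} {b} {a} {c} t = least-cong λ d → T-ext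
    (λ p → does⁺ (twin? E v b c d) (twin-trans G (twin-sym G t) (does⁻ (twin? E v b a d) p)))
    (λ p → does⁺ (twin? E v b a d) (twin-trans G t (does⁻ (twin? E v b c d) p)))

  twin-twinRep : ∀ v b a → Twin E v b a (twinRep E v b a)
  twin-twinRep v b a = does⁻ (twin? E v b a (twinRep E v b a))
    (least-satisfies (λ c → does (twin? E v b a c)) a (does⁺ (twin? E v b a a) (inj₁ refl)))

  twinRep-injective : ∀ {v b a c} → twinRep E v b a ≡ twinRep E v b c → Twin E v b a c
  twinRep-injective {v} {b} {a} {c} e = twin-trans G (twin-twinRep v b a)
    (subst (λ r → Twin E v b r c) (sym e) (twin-sym G (twin-twinRep v b c)))

-- A graph is determined by a link and its twin representatives

module _ {n : ℕ} (G G′ : GoodSystem (suc n)) where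
  private
    module G = GoodSystem G
    module G′ = GoodSystem G′

  -- In `G` the vertices `a` and `c` are twins at `b`, so their representatives coincide. The same
  -- then holds in `G′`, making them twins there, and `a ≢ c` leaves only the alternative that
  -- contains the wanted non-edge.
  cherry-agrees : ∀ {v b} → twinRep G.E v b ≗ twinRep G′.E v b → ∀ {a c} → a ≢ c →
    G.E v b a ≡ true → G.E v b c ≡ true → G.E v a c ≡ false → G.E b a c ≡ false → G′.E b a c ≡ false
  cherry-agrees reps≡ a≢c p q r s
    with twinRep-injective G′ (trans (sym (reps≡ _)) (trans (twinRep-cong G (inj₂ (p , q , r , s))) (reps≡ _)))
  ... | inj₁ a≡c               = contradiction a≡c a≢c
  ... | inj₂ (_ , _ , _ , bac) = bac

  -- One direction suffices, as the hypotheses are symmetric in `G` and `G′`. A triple containing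
  -- `v` is read off the link. Any other triple on which the graphs differ spans exactly two link
  -- edges, and `cherry-agrees` applies at their common vertex.
  edges-agree : ∀ v → (∀ b a → G.E v b a ≡ G′.E v b a) → (∀ b → twinRep G.E v b ≗ twinRep G′.E v b) →
    ∀ {a b c} → a ≢ b → a ≢ c → b ≢ c → G.E a b c ≡ false → G′.E a b c ≡ false
  edges-agree v link≡ reps≡ {a} {b} {c} a≢b a≢c b≢c abc with G′.E a b c in abc′
  ... | false = refl
  ... | true with v Fin.≟ a | v Fin.≟ b | v Fin.≟ c
  ...   | yes refl | _ | _ = trans (sym abc′) (trans (sym (link≡ b c)) abc)
  ...   | no _ | yes refl | _ = trans (sym abc′) (trans (G′.swap₁ a b c)
            (trans (sym (link≡ a c)) (trans (G.swap₁ b a c) abc)))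
  ...   | no _ | no _ | yes refl = trans (sym abc′) (trans (rot′ a b c)
            (trans (sym (link≡ a b)) (trans (sym (rot a b c)) abc)))
    where
    rot : ∀ a b c → G.E a b c ≡ G.E c a b
    rot a b c = trans (G.swap₂ a b c) (G.swap₁ a c b)
    rot′ : ∀ a b c → G′.E a b c ≡ G′.E c a b
    rot′ a b c = trans (G′.swap₂ a b c) (G′.swap₁ a c b)
  -- The three link bits are shared. As `a b c` is a non-edge of `G`, their sum is not 1; as it is
  -- an edge of `G′`, their sum is neither 0 nor 3.
  ...   | no v≢a | no v≢b | no v≢c = center (two-link-edges _ _ _
            (subst (Good₄ (G.E v a b) (G.E v a c) (G.E v b c)) abc (G.good v≢a v≢b a≢b v≢c a≢c b≢c))
            (subst₂ (λ x y → Good₄ x y (G.E v b c) true) (sym (link≡ a b)) (sym (link≡ a c))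
              (subst₂ (Good₄ (G′.E v a b) (G′.E v a c)) (sym (link≡ b c)) abc′ (G′.good v≢a v≢b a≢b v≢c a≢c b≢c))))
    where
    two-link-edges : ∀ x y z → Good₄ x y z false → Good₄ x y z true →
      (x ≡ true × y ≡ true × z ≡ false) ⊎ (x ≡ true × y ≡ false × z ≡ true) ⊎
      (x ≡ false × y ≡ true × z ≡ true)
    two-link-edges true  true  false _ _ = inj₁ (refl , refl , refl)
    two-link-edges true  false true  _ _ = inj₂ (inj₁ (refl , refl , refl))
    two-link-edges false true  true  _ _ = inj₂ (inj₂ (refl , refl , refl))
    two-link-edges true  true  true  _ ()
    two-link-edges true  false false () _
    two-link-edges false true  false () _
    two-link-edges false false true  () _
    two-link-edges false false false _ ()
    center : _ → true ≡ false
    center (inj₁ (ab , ac , bc)) = trans (sym abc′)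
      (cherry-agrees (reps≡ a) b≢c ab ac bc abc)
    center (inj₂ (inj₁ (ab , ac , bc))) = trans (sym (trans (sym (G′.swap₁ a b c)) abc′))
      (cherry-agrees (reps≡ b) a≢c (trans (G.swap₂ _ _ _) ab) bc ac (trans (G.swap₁ _ _ _) abc))
    center (inj₂ (inj₂ (ab , ac , bc))) =
      trans (sym (trans (sym (trans (G′.swap₂ a b c) (G′.swap₁ a c b))) abc′))
      (cherry-agrees (reps≡ c) a≢b (trans (G.swap₂ _ _ _) ac) (trans (G.swap₂ _ _ _) bc) ab
        (trans (sym (trans (G.swap₂ a b c) (G.swap₁ a c b))) abc))

-- From sorted vertices to arbitrary ones

module _ {n : ℕ} (Q : Fin n → Fin n → Fin n → Fin n → Set)
  (swap₁ : ∀ {a b c d} → Q a b c d → Q b a c d)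
  (swap₂ : ∀ {a b c d} → Q a b c d → Q a c b d)
  (swap₃ : ∀ {a b c d} → Q a b c d → Q a b d c)
  (sorted : ∀ {a b c d} → a Fin.< b → b Fin.< c → c Fin.< d → Q a b c d) where

  private
    insert-4th : ∀ {a b c d} → a Fin.< b → b Fin.< c → a ≢ d → b ≢ d → c ≢ d → Q a b c d
    insert-4th {a} {b} {c} {d} a<b b<c a≢d b≢d c≢d with Fin.<-cmp c d | Fin.<-cmp b d | Fin.<-cmp a d
    ... | tri≈ _ c≡d _ | _ | _ = contradiction c≡d c≢d
    ... | tri< c<d _ _ | _ | _ = sorted a<b b<c c<d
    ... | tri> _ _ d<c | tri≈ _ b≡d _ | _ = contradiction b≡d b≢d
    ... | tri> _ _ d<c | tri< b<d _ _ | _ = swap₃ (sorted a<b b<d d<c)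
    ... | tri> _ _ d<c | tri> _ _ d<b | tri≈ _ a≡d _ = contradiction a≡d a≢d
    ... | tri> _ _ d<c | tri> _ _ d<b | tri< a<d _ _ = swap₃ (swap₂ (sorted a<d d<b b<c))
    ... | tri> _ _ d<c | tri> _ _ d<b | tri> _ _ d<a = swap₃ (swap₂ (swap₁ (sorted d<a a<b b<c)))

    insert-3rd : ∀ {a b c d} → a Fin.< b → a ≢ c → b ≢ c → a ≢ d → b ≢ d → c ≢ d → Q a b c d
    insert-3rd {a} {b} {c} a<b a≢c b≢c a≢d b≢d c≢d with Fin.<-cmp b c | Fin.<-cmp a c
    ... | tri≈ _ b≡c _ | _ = contradiction b≡c b≢c
    ... | tri< b<c _ _ | _ = insert-4th a<b b<c a≢d b≢d c≢d
    ... | tri> _ _ c<b | tri≈ _ a≡c _ = contradiction a≡c a≢c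
    ... | tri> _ _ c<b | tri< a<c _ _ = swap₂ (insert-4th a<c c<b a≢d c≢d b≢d)
    ... | tri> _ _ c<b | tri> _ _ c<a = swap₂ (swap₁ (insert-4th c<a a<b c≢d a≢d b≢d))

  -- Insertion sort: the first two vertices are ordered, then the third and the fourth are inserted,
  -- each move being an adjacent transposition under which `Q` is invariant.
  from-sorted-quads : ∀ {a b c d} → a ≢ b → a ≢ c → b ≢ c → a ≢ d → b ≢ d → c ≢ d → Q a b c d
  from-sorted-quads {a} {b} a≢b a≢c b≢c a≢d b≢d c≢d with Fin.<-cmp a b
  ... | tri≈ _ a≡b _ = contradiction a≡b a≢b
  ... | tri< a<b _ _ = insert-3rd a<b a≢c b≢c a≢d b≢d c≢d
  ... | tri> _ _ b<a = swap₁ (insert-3rd b<a b≢c a≢c b≢d a≢d c≢d)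

Good₄-swap₁₂ : ∀ w x y z → Good₄ w x y z → Good₄ x w y z
Good₄-swap₁₂ w x y z g rewrite ℕ.+-comm (b2n x) (b2n w) = g

Good₄-swap₂₃ : ∀ w x y z → Good₄ w x y z → Good₄ w y x z
Good₄-swap₂₃ w x y z g
  rewrite ℕ.+-assoc (b2n w) (b2n y) (b2n x) | ℕ.+-comm (b2n y) (b2n x)
        | sym (ℕ.+-assoc (b2n w) (b2n x) (b2n y)) = g

Good₄-swap₃₄ : ∀ w x y z → Good₄ w x y z → Good₄ w x z y
Good₄-swap₃₄ w x y z g
  rewrite ℕ.+-assoc (b2n w + b2n x) (b2n z) (b2n y) | ℕ.+-comm (b2n z) (b2n y)
        | sym (ℕ.+-assoc (b2n w + b2n x) (b2n y) (b2n z)) = g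

-- The disjunction over all six orders of the triple. When `H` has only sorted triples, at most the
-- sorted order can contribute, and no order does if a vertex repeats.
unorderedEdge : ∀ {n} → Hypergraph n → Fin n → Fin n → Fin n → Bool
unorderedEdge H a b c = s a b c ∨ s b c a ∨ s c a b
  where
  s : _ → _ → _ → Bool
  s x y z = isEdge H (x , y , z) ∨ isEdge H (y , x , z)

unorderedEdge-swap₁ : ∀ {n} (H : Hypergraph n) a b c → unorderedEdge H a b c ≡ unorderedEdge H b a c
unorderedEdge-swap₁ H a b c = perm (isEdge H (a , b , c)) (isEdge H (b , a , c)) (isEdge H (b , c , a))
    (isEdge H (c , b , a)) (isEdge H (c , a , b)) (isEdge H (a , c , b))
  where
  perm : ∀ p q r s t u → (p ∨ q) ∨ (r ∨ s) ∨ (t ∨ u) ≡ (q ∨ p) ∨ (u ∨ t) ∨ (s ∨ r)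
  perm p q r s t u = cong₂ _∨_ (Bool.∨-comm p q)
    (trans (Bool.∨-comm (r ∨ s) (t ∨ u)) (cong₂ _∨_ (Bool.∨-comm t u) (Bool.∨-comm r s)))

unorderedEdge-swap₂ : ∀ {n} (H : Hypergraph n) a b c → unorderedEdge H a b c ≡ unorderedEdge H a c b
unorderedEdge-swap₂ H a b c = perm (isEdge H (a , b , c)) (isEdge H (b , a , c)) (isEdge H (b , c , a))
    (isEdge H (c , b , a)) (isEdge H (c , a , b)) (isEdge H (a , c , b))
  where
  perm : ∀ p q r s t u → (p ∨ q) ∨ (r ∨ s) ∨ (t ∨ u) ≡ (u ∨ t) ∨ (s ∨ r) ∨ (q ∨ p)
  perm p q r s t u = trans (Bool.∨-comm (p ∨ q) _) (trans (cong (_∨ (p ∨ q)) (Bool.∨-comm (r ∨ s) (t ∨ u)))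
    (trans (Bool.∨-assoc (t ∨ u) (r ∨ s) (p ∨ q))
      (cong₂ _∨_ (Bool.∨-comm t u) (cong₂ _∨_ (Bool.∨-comm r s) (Bool.∨-comm p q)))))

module _ {n : ℕ} (H : Hypergraph n) (H⊆ : ∀ {t} → t ∈ H → Sorted t) where
  private
    unsorted : ∀ {t} → ¬ Sorted t → isEdge H t ≡ false
    unsorted ¬s = ¬T⇒false (¬s ∘ H⊆ ∘ isEdge⁻ {H = H})

  unorderedEdge-loopless : ∀ a c → unorderedEdge H a a c ≡ false
  unorderedEdge-loopless a c = or-false
      (unsorted {a , a , c} (λ (p , _) → ℕ.<-irrefl refl p))
      (unsorted {a , c , a} (λ (p , q) → ℕ.<-asym p q))
      (unsorted {c , a , a} (λ (_ , q) → ℕ.<-irrefl refl q))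
    where
    or-false : ∀ {p q r} → p ≡ false → q ≡ false → r ≡ false → (p ∨ p) ∨ (q ∨ r) ∨ (r ∨ q) ≡ false
    or-false refl refl refl = refl

  unorderedEdge-sorted : ∀ {a b c} → a Fin.< b → b Fin.< c → unorderedEdge H a b c ≡ isEdge H (a , b , c)
  unorderedEdge-sorted {a} {b} {c} a<b b<c = or-first
      (unsorted {b , a , c} (λ (p , _) → ℕ.<-asym a<b p))
      (unsorted {b , c , a} (λ (_ , q) → ℕ.<-asym (ℕ.<-trans a<b b<c) q))
      (unsorted {c , b , a} (λ (p , _) → ℕ.<-asym b<c p))
      (unsorted {c , a , b} (λ (p , _) → ℕ.<-asym (ℕ.<-trans a<b b<c) p))
      (unsorted {a , c , b} (λ (_ , q) → ℕ.<-asym b<c q))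
    where
    or-first : ∀ {p q r s t u} → q ≡ false → r ≡ false → s ≡ false → t ≡ false → u ≡ false →
      (p ∨ q) ∨ (r ∨ s) ∨ (t ∨ u) ≡ p
    or-first refl refl refl refl refl = trans (Bool.∨-identityʳ _) (Bool.∨-identityʳ _)

  goodSystem : T (isGood H) → GoodSystem n
  goodSystem good = record
    { E        = E
    ; swap₁    = unorderedEdge-swap₁ H
    ; swap₂    = unorderedEdge-swap₂ H
    ; loopless = unorderedEdge-loopless
    ; good     = from-sorted-quads (λ a b c d → Good₄ (E a b c) (E a b d) (E a c d) (E b c d))
        -- Exchanging two vertices exchanges the triples that omit them. The bits omit the 4th, 3rd,
        -- 2nd and 1st vertex in turn, so the transpositions of vertices 1-2, 2-3, 3-4 act on bits
        -- 3-4, 2-3, 1-2; the other two triples are merely reordered.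
        (λ {a} {b} {c} {d} g → subst₂ (λ x y → Good₄ x y (E b c d) (E a c d))
          (unorderedEdge-swap₁ H a b c) (unorderedEdge-swap₁ H a b d)
          (Good₄-swap₃₄ (E a b c) (E a b d) (E a c d) (E b c d) g))
        (λ {a} {b} {c} {d} g → subst₂ (λ x y → Good₄ x (E a c d) (E a b d) y)
          (unorderedEdge-swap₂ H a b c) (unorderedEdge-swap₁ H b c d)
          (Good₄-swap₂₃ (E a b c) (E a b d) (E a c d) (E b c d) g))
        (λ {a} {b} {c} {d} g → subst₂ (λ x y → Good₄ (E a b d) (E a b c) x y)
          (unorderedEdge-swap₂ H a c d) (unorderedEdge-swap₂ H b c d)
          (Good₄-swap₁₂ (E a b c) (E a b d) (E a c d) (E b c d) g))
        (λ a<b b<c c<d → good-sorted a<b b<c c<d)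
    }
    where
    E = unorderedEdge H
    good-sorted : ∀ {a b c d} → a Fin.< b → b Fin.< c → c Fin.< d →
      Good₄ (E a b c) (E a b d) (E a c d) (E b c d)
    good-sorted a<b b<c c<d
      rewrite unorderedEdge-sorted a<b b<c | unorderedEdge-sorted a<b (ℕ.<-trans b<c c<d)
            | unorderedEdge-sorted (ℕ.<-trans a<b b<c) c<d | unorderedEdge-sorted b<c c<d
      = isGood⁻ {H = H} good a<b b<c c<d

-- Coding a graph by a table

bit : Bool → Fin 2
bit false = zero
bit true  = suc zero

bit-injective : ∀ {b c} → bit b ≡ bit c → b ≡ c
bit-injective {false} {false} _ = refl
bit-injective {true}  {true}  _ = refl

-- With vertex `zero` as the fixed `v`, these are exactly the data `edges-agree` asks for: a link
-- bit and a twin representative, packed into one of `2 * suc n` values.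
codeAt : ∀ {n} → Hypergraph (suc n) → Fin (suc n) → Fin (suc n) → Fin (2 * suc n)
codeAt H b a = combine (bit (unorderedEdge H zero b a)) (twinRep (unorderedEdge H) zero b a)

code : ∀ {n} → Hypergraph (suc n) → Fin ((2 * suc n) ^ (suc n * suc n))
code {n} H = funToFin (uncurry (codeAt H) ∘ remQuot {suc n} (suc n))

code-injective : ∀ {n} {H H′ : Hypergraph (suc n)} →
  H ∈ filterᵇ isGood (all3graphs (suc n)) → H′ ∈ filterᵇ isGood (all3graphs (suc n)) →
  code H ≡ code H′ → H ≡ H′
code-injective {n} {H} {H′} H∈ H′∈ e = sublists-extensional (triples-unique _) H∈s H′∈s λ t∈ →
  let s = ∈-triples⁻ t∈ in
    (λ p → same H∈ H′∈ agree s p) , (λ p → same H′∈ H∈ (λ b a → sym (agree b a)) s p)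
  where
  H∈s  = proj₁ (∈.∈-filter⁻ (T? ∘ isGood) {xs = all3graphs (suc n)} H∈)
  H′∈s = proj₁ (∈.∈-filter⁻ (T? ∘ isGood) {xs = all3graphs (suc n)} H′∈)
  agree : ∀ b a → codeAt H b a ≡ codeAt H′ b a
  agree b a = subst (λ (b , a) → codeAt H b a ≡ codeAt H′ b a) (Fin.remQuot-combine b a)
    (funToFin-injective (uncurry (codeAt H) ∘ remQuot {suc n} (suc n))
      (uncurry (codeAt H′) ∘ remQuot {suc n} (suc n)) e (combine b a))
  same : ∀ {H H′} → H ∈ filterᵇ isGood (all3graphs (suc n)) → H′ ∈ filterᵇ isGood (all3graphs (suc n)) →
    (∀ b a → codeAt H b a ≡ codeAt H′ b a) → ∀ {t} → Sorted t → t ∈ H → t ∈ H′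
  same {H} {H′} H∈ H′∈ agree {a , b , c} (a<b , b<c) t∈ with T? (isEdge H′ (a , b , c))
  ... | yes p = isEdge⁻ p
  -- If the triple were missing from `H′`, then `edges-agree`, applied from `H′` to `H`, would make
  -- it a non-edge of `H`.
  ... | no ¬p = contradiction (trans (sym (T⇒true (isEdge⁺ {H = H} t∈)))
      (trans (sym (unorderedEdge-sorted H (s H∈) a<b b<c))
        (edges-agree (g H′∈) (g H∈) zero
          (λ b a → sym (bit-injective (proj₁ (parts b a)))) (λ b a → sym (proj₂ (parts b a)))
          (Fin.<⇒≢ a<b) (Fin.<⇒≢ (ℕ.<-trans a<b b<c)) (Fin.<⇒≢ b<c)
          (trans (unorderedEdge-sorted H′ (s H′∈) a<b b<c) (¬T⇒false ¬p))))) λ ()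
    where
    parts = λ b a → Fin.combine-injective (bit (unorderedEdge H zero b a)) _ _ _ (agree b a)
    s : ∀ {H} → H ∈ filterᵇ isGood (all3graphs (suc n)) → ∀ {t} → t ∈ H → Sorted t
    s {H} H∈ t∈ = ∈-triples⁻ (∈-sublist⇒∈
      (proj₁ (∈.∈-filter⁻ (T? ∘ isGood) {xs = all3graphs (suc n)} H∈)) t∈)
    g : ∀ {H} → H ∈ filterᵇ isGood (all3graphs (suc n)) → GoodSystem (suc n)
    g {H} H∈ = goodSystem H (s H∈) (proj₂ (∈.∈-filter⁻ (T? ∘ isGood) {xs = all3graphs (suc n)} H∈))

countGood-upper : ∀ n → 2 ≤ n → countGood n ≤ n ^ (2 * (n * n))
countGood-upper n@(suc m) 2≤n = begin
  countGood n           ≤⟨ length≤-by-injection (good-unique n) code code-injective ⟩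
  -- The factor 2 is absorbed into a second factor `n`, which gives the constant 2 in the exponent.
  (2 * n) ^ (n * n)     ≤⟨ ℕ.^-monoˡ-≤ (n * n) (ℕ.*-monoˡ-≤ n 2≤n) ⟩
  (n * n) ^ (n * n)     ≡⟨ cong (λ k → (n * k) ^ (n * n)) (sym (ℕ.*-identityʳ n)) ⟩
  (n ^ 2) ^ (n * n)     ≡⟨ ℕ.^-*-assoc n 2 (n * n) ⟩
  n ^ (2 * (n * n))     ∎
  where open ℕ.≤-Reasoning

-- The lower bound

-- Pigeonhole: the `suc (length xs)` candidates from 0 to `length xs` cannot all occur in `xs`.
mex : (xs : List ℕ) → ∃ λ m → m ∉ xs × m ≤ length xs
mex xs with i , i∉ ← Fin.¬∀⟶∃¬ (suc (length xs)) (λ i → toℕ i ∈ xs) (λ i → Dec∈._∈?_ ℕ._≟_ (toℕ i) xs)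
                       (λ all∈ → ℕ.<-irrefl refl (≤length-by-injection toℕ all∈ Fin.toℕ-injective))
  = toℕ i , i∉ , Fin.toℕ≤pred[n] i

-- An enumeration of the natural numbers outside a list.
pick : List ℕ → ℕ → ℕ
pick xs zero    = proj₁ (mex xs)
pick xs (suc x) = pick (proj₁ (mex xs) ∷ xs) x

pick-∉ : ∀ xs x → pick xs x ∉ xs
pick-∉ xs zero    = proj₁ (proj₂ (mex xs))
pick-∉ xs (suc x) = pick-∉ (proj₁ (mex xs) ∷ xs) x ∘ there

pick-≤ : ∀ xs x → pick xs x ≤ x + length xs
pick-≤ xs zero    = proj₂ (proj₂ (mex xs))
pick-≤ xs (suc x) = subst (pick xs (suc x) ≤_) (ℕ.+-suc x (length xs)) (pick-≤ (proj₁ (mex xs) ∷ xs) x)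

-- Each value passed over is added to the forbidden list, so no later pick can repeat it.
pick-injective : ∀ xs {x y} → pick xs x ≡ pick xs y → x ≡ y
pick-injective xs {zero}  {zero}  e = refl
pick-injective xs {zero}  {suc y} e = contradiction (here (sym e)) (pick-∉ (proj₁ (mex xs) ∷ xs) y)
pick-injective xs {suc x} {zero}  e = contradiction (here e) (pick-∉ (proj₁ (mex xs) ∷ xs) x)
pick-injective xs {suc x} {suc y} e = cong suc (pick-injective (proj₁ (mex xs) ∷ xs) e)

-- The greedy Latin array: the (i , j) entry is the (g i j)-th value that occurs neither above
-- it nor to its left.
greedy : (ℕ → ℕ → ℕ) → ℕ → ℕ → ℕ
above left : (ℕ → ℕ → ℕ) → ℕ → ℕ → List ℕ
greedy g i j = pick (above g i j ++ left g i j) (g i j)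
above g zero    j = []
above g (suc i) j = greedy g i j ∷ above g i j
left g i zero    = []
left g i (suc j) = greedy g i j ∷ left g i j

∈-above : ∀ g {i i′} j → i < i′ → greedy g i j ∈ above g i′ j
∈-above g {i} {suc i′} j (s≤s i≤i′) with ℕ.m≤n⇒m<n∨m≡n i≤i′
... | inj₁ i<i′ = there (∈-above g j i<i′)
... | inj₂ refl = here refl

∈-left : ∀ g i {j j′} → j < j′ → greedy g i j ∈ left g i j′
∈-left g i {j} {suc j′} (s≤s j≤j′) with ℕ.m≤n⇒m<n∨m≡n j≤j′
... | inj₁ j<j′ = there (∈-left g i j<j′)
... | inj₂ refl = here refl

length-above : ∀ g i j → length (above g i j) ≡ i
length-above g zero    j = refl
length-above g (suc i) j = cong suc (length-above g i j)

length-left : ∀ g i j → length (left g i j) ≡ j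
length-left g i zero    = refl
length-left g i (suc j) = cong suc (length-left g i j)

Latin : (ℕ → ℕ → ℕ) → Set
Latin f = (∀ {i i′} j → i < i′ → f i j ≢ f i′ j) × (∀ i {j j′} → j < j′ → f i j ≢ f i j′)

greedy-latin : ∀ g → Latin (greedy g)
greedy-latin g =
  (λ {i} {i′} j i<i′ e → pick-∉ _ (g i′ j) (∈.∈-++⁺ˡ (subst (_∈ above g i′ j) e (∈-above g j i<i′)))) ,
  (λ i {j} {j′} j<j′ e → pick-∉ _ (g i j′)
    (∈.∈-++⁺ʳ (above g i j′) (subst (_∈ left g i j′) e (∈-left g i j<j′))))

-- Only `i + j` entries lie above or to the left of the cell, so the pick is at most
-- `g i j + (i + j)`. With `k` vertices in each of A and B and `3 * k` symbols in C, this is the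
-- origin of `5 * k ≤ n`.
greedy-< : ∀ {k} g {i j} → g i j < k → i < k → j < k → greedy g i j < 3 * k
greedy-< {k} g {i} {j} gij<k i<k j<k = begin-strict
  greedy g i j                                        ≤⟨ pick-≤ (above g i j ++ left g i j) (g i j) ⟩
  g i j + length (above g i j ++ left g i j)          ≡⟨ cong (g i j +_) (List.length-++ (above g i j)) ⟩
  g i j + (length (above g i j) + length (left g i j))
    ≡⟨ cong₂ (λ x y → g i j + (x + y)) (length-above g i j) (length-left g i j) ⟩
  g i j + (i + j)                                     <⟨ ℕ.+-mono-< gij<k (ℕ.+-mono-< i<k j<k) ⟩
  k + (k + k)                                         ≡⟨ cong (λ x → k + (k + x)) (sym (ℕ.+-identityʳ k)) ⟩
  3 * k                                               ∎
  where open ℕ.≤-Reasoning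

-- Equal arrays have equal forbidden lists at every cell, and for a fixed list `pick` is injective
-- in the index.
greedy-determines : ∀ {k} g h → (∀ {i j} → i < k → j < k → greedy g i j ≡ greedy h i j) →
  ∀ {i j} → i < k → j < k → g i j ≡ h i j
greedy-determines {k} g h same {i} {j} i<k j<k = pick-injective (above g i j ++ left g i j)
  (trans (same i<k j<k) (cong (λ xs → pick xs (h i j))
    (sym (cong₂ _++_ (above-same (ℕ.<⇒≤ i<k)) (left-same (ℕ.<⇒≤ j<k))))))
  where
  above-same : ∀ {i} → i ≤ k → above g i j ≡ above h i j
  above-same {zero}  _   = refl
  above-same {suc i} i<k = cong₂ _∷_ (same i<k j<k) (above-same (ℕ.<⇒≤ i<k))
  left-same : ∀ {j} → j ≤ k → left g i j ≡ left h i j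
  left-same {zero}  _   = refl
  left-same {suc j} j<k = cong₂ _∷_ (same i<k j<k) (left-same (ℕ.<⇒≤ j<k))

-- The graph built from a Latin array

data Part : Set where
  inA inB inC : ℕ → Part

-- The lexicographic order, as a data type, so that matching on a chain enumerates the types of
-- sorted 4-sets.
data _≺_ : Part → Part → Set where
  AA : ∀ {i i′} → i < i′ → inA i ≺ inA i′
  AB : ∀ {i j} → inA i ≺ inB j
  AC : ∀ {i c} → inA i ≺ inC c
  BB : ∀ {j j′} → j < j′ → inB j ≺ inB j′
  BC : ∀ {j c} → inB j ≺ inC c
  CC : ∀ {c c′} → c < c′ → inC c ≺ inC c′

part : ℕ → ℕ → Part
part k x with x <? k | x <? k + k
... | yes _ | _     = inA x
... | no _  | yes _ = inB (x ∸ k)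
... | no _  | no _  = inC (x ∸ (k + k))

part-mono : ∀ k {x y} → x < y → part k x ≺ part k y
part-mono k {x} {y} x<y with x <? k | x <? k + k | y <? k | y <? k + k
... | yes _   | _       | yes _   | _      = AA x<y
... | yes _   | _       | no _    | yes _  = AB
... | yes _   | _       | no _    | no _   = AC
... | no x≮k  | _       | yes y<k | _      = contradiction (ℕ.<-trans x<y y<k) x≮k
... | no x≮k  | yes _   | no _    | yes _  = BB (ℕ.∸-monoˡ-< x<y (ℕ.≮⇒≥ x≮k))
... | no _    | yes _   | no _    | no _   = BC
... | no _    | no x≮2k | no _    | yes y<2k = contradiction (ℕ.<-trans x<y y<2k) x≮2k
... | no _    | no x≮2k | no _    | no _   = CC (ℕ.∸-monoˡ-< x<y (ℕ.≮⇒≥ x≮2k))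

part-A : ∀ {k i} → i < k → part k i ≡ inA i
part-A {k} {i} i<k with i <? k
... | yes _  = refl
... | no i≮k = contradiction i<k i≮k

part-B : ∀ {k j} → j < k → part k (k + j) ≡ inB j
part-B {k} {j} j<k with k + j <? k | k + j <? k + k
... | yes p | _     = contradiction p (ℕ.m+n≮m k j)
... | no _  | yes _ = cong inB (ℕ.m+n∸m≡n k j)
... | no _  | no ¬p = contradiction (ℕ.+-monoʳ-< k j<k) ¬p

part-C : ∀ k c → part k (k + k + c) ≡ inC c
part-C k c with k + k + c <? k | k + k + c <? k + k
... | yes p | _     = contradiction (subst (_< k) (ℕ.+-assoc k k c) p) (ℕ.m+n≮m k (k + c))
... | no _  | yes p = contradiction p (ℕ.m+n≮m (k + k) c)
... | no _  | no _  = cong inC (ℕ.m+n∸m≡n (k + k) c)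

-- Read on sorted triples: the last clause makes AAA, AAC, ABB, BBB, BCC and CCC non-edges, and a
-- transversal triple is removed exactly when it lies on the graph of `f`.
χ : (ℕ → ℕ → ℕ) → Part → Part → Part → Bool
χ f (inA _) (inA _) (inB _) = true
χ f (inB _) (inB _) (inC _) = true
χ f (inA _) (inC _) (inC _) = true
χ f (inA i) (inB j) (inC c) = not (f i j ≡ᵇ c)
χ f _       _       _       = false

not-both : ∀ {x y c} → x ≢ y → (x ≡ᵇ c) ≡ true → (y ≡ᵇ c) ≡ true → A
not-both x≢y p q =
  contradiction (trans (ℕ.≡ᵇ⇒≡ _ _ (true⇒T p)) (sym (ℕ.≡ᵇ⇒≡ _ _ (true⇒T q)))) x≢y

-- A 4-set without transversal triples spans 0, 2 or 3 edges. AABC, ABBC and ABCC have one fixed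
-- edge and two transversal triples, so they are bad only if both are removed; this is excluded by
-- the columns of `f`, by its rows, and by `f` being single-valued, respectively.
χ-good : ∀ {f} → Latin f → ∀ {p q r s} → p ≺ q → q ≺ r → r ≺ s →
  Good₄ (χ f p q r) (χ f p q s) (χ f p r s) (χ f q r s)
χ-good _ (AA _) (AA _) (AA _) = _
χ-good _ (AA _) (AA _) AB     = _
χ-good _ (AA _) (AA _) AC     = _
χ-good _ (AA _) AB     (BB _) = _
χ-good {f} (cols , _) (AA {i} {i′} i<i′) (AB {j = j}) (BC {c = c})
  with f i j ≡ᵇ c in p | f i′ j ≡ᵇ c in q
... | false | false = _
... | false | true  = _
... | true  | false = _
... | true  | true  = not-both (cols j i<i′) p q
χ-good _ (AA _) AC     (CC _) = _
χ-good _ AB     (BB _) (BB _) = _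
χ-good {f} (_ , rows) (AB {i}) (BB {j} {j′} j<j′) (BC {c = c})
  with f i j ≡ᵇ c in p | f i j′ ≡ᵇ c in q
... | false | false = _
... | false | true  = _
... | true  | false = _
... | true  | true  = not-both (rows i j<j′) p q
χ-good {f} _ (AB {i} {j}) (BC {c = c}) (CC {c′ = c′} c<c′)
  with f i j ≡ᵇ c in p | f i j ≡ᵇ c′ in q
... | false | false = _
... | false | true  = _
... | true  | false = _
... | true  | true  = contradiction
  (trans (sym (ℕ.≡ᵇ⇒≡ (f i j) c (true⇒T p))) (ℕ.≡ᵇ⇒≡ (f i j) c′ (true⇒T q))) (ℕ.<⇒≢ c<c′)
χ-good _ AC     (CC _) (CC _) = _
χ-good _ (BB _) (BB _) (BB _) = _
χ-good _ (BB _) (BB _) BC     = _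
χ-good _ (BB _) BC     (CC _) = _
χ-good _ BC     (CC _) (CC _) = _
χ-good _ (CC _) (CC _) (CC _) = _

χ-triple : ∀ {n} → ℕ → (ℕ → ℕ → ℕ) → Triple n → Bool
χ-triple k f (a , b , c) = χ f (part k (toℕ a)) (part k (toℕ b)) (part k (toℕ c))

graph : ∀ n → ℕ → (ℕ → ℕ → ℕ) → Hypergraph n
graph n k f = filterᵇ (χ-triple k f) (triples n)

isEdge-graph : ∀ {n k f} {t : Triple n} → Sorted t → isEdge (graph n k f) t ≡ χ-triple k f t
isEdge-graph {n} {k} {f} {t} s = T-ext
  (λ p → proj₂ (∈.∈-filter⁻ (T? ∘ χ-triple k f) {xs = triples n} (isEdge⁻ p)))
  (λ p → isEdge⁺ (∈.∈-filter⁺ (T? ∘ χ-triple k f) (∈-triples⁺ s) p))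

graph-good : ∀ n k {f} → Latin f → T (isGood (graph n k f))
graph-good n k {f} latin = isGood⁺ {H = graph n k f} good
  where
  good : ∀ {a b c d} → a Fin.< b → b Fin.< c → c Fin.< d → GoodQuad (graph n k f) a b c d
  good {a} {b} {c} {d} a<b b<c c<d
    rewrite isEdge-graph {k = k} {f} {a , b , c} (a<b , b<c)
          | isEdge-graph {k = k} {f} {a , b , d} (a<b , ℕ.<-trans b<c c<d)
          | isEdge-graph {k = k} {f} {a , c , d} (ℕ.<-trans a<b b<c , c<d)
          | isEdge-graph {k = k} {f} {b , c , d} (b<c , c<d)
    = χ-good latin (part-mono k a<b) (part-mono k b<c) (part-mono k c<d)

-- The triple of vertices `i` of A, `j` of B and `f i j` of C is missing from the first graph, hence
-- from the second, which forces `f′ i j` to be the same symbol. The bounds ensure that this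
-- C-vertex exists.
graph-determines : ∀ {n k f f′} → 5 * k ≤ n → graph n k f ≡ graph n k f′ →
  ∀ {i j} → i < k → j < k → f i j < 3 * k → f i j ≡ f′ i j
graph-determines {n} {k} {f} {f′} 5k≤n e {i} {j} i<k j<k fij<3k =
  sym (ℕ.≡ᵇ⇒≡ (f′ i j) (f i j) (true⇒T (Bool.not-injective
    (trans (sym (χ-abc f′)) (trans (sym (isEdge-graph {k = k} {f′} {t} sorted))
      (trans (cong (λ H → isEdge H t) (sym e)) (trans (isEdge-graph {k = k} {f} {t} sorted)
        (trans (χ-abc f) (cong not (T⇒true (ℕ.≡⇒≡ᵇ (f i j) (f i j) refl)))))))))))
  where
  open ℕ.≤-Reasoning
  c<n : k + k + f i j < n
  c<n = begin-strict
    k + k + f i j    <⟨ ℕ.+-monoʳ-< (k + k) fij<3k ⟩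
    k + k + 3 * k    ≡⟨ ℕ.+-assoc k k (3 * k) ⟩
    5 * k            ≤⟨ 5k≤n ⟩
    n                ∎
  b<c : k + j < k + k + f i j
  b<c = ℕ.<-≤-trans (ℕ.+-monoʳ-< k j<k) (ℕ.m≤m+n (k + k) (f i j))
  a<b : i < k + j
  a<b = ℕ.<-≤-trans i<k (ℕ.m≤m+n k j)
  b<n : k + j < n
  b<n = ℕ.<-trans b<c c<n
  a<n : i < n
  a<n = ℕ.<-trans a<b b<n
  t : Triple n
  t = fromℕ< a<n , fromℕ< b<n , fromℕ< c<n
  sorted : Sorted t
  sorted = subst₂ _<_ (sym (Fin.toℕ-fromℕ< a<n)) (sym (Fin.toℕ-fromℕ< b<n)) a<b
         , subst₂ _<_ (sym (Fin.toℕ-fromℕ< b<n)) (sym (Fin.toℕ-fromℕ< c<n)) b<c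
  χ-abc : ∀ h → χ-triple k h t ≡ not (h i j ≡ᵇ f i j)
  χ-abc h rewrite Fin.toℕ-fromℕ< a<n | Fin.toℕ-fromℕ< b<n | Fin.toℕ-fromℕ< c<n
                | part-A i<k | part-B j<k | part-C k (f i j) = refl

-- Counting the arrays

-- A number read as a `k` by `k` table of base-`k` digits, extended by 0 to the total function that
-- `greedy` takes.
array : ∀ {k} → Fin (k ^ (k * k)) → ℕ → ℕ → ℕ
array {k} c i j with i <? k | j <? k
... | yes i<k | yes j<k = toℕ (finToFun {k} {k * k} c (combine (fromℕ< i<k) (fromℕ< j<k)))
... | _       | _       = 0

array-toℕ : ∀ {k} (c : Fin (k ^ (k * k))) (i j : Fin k) →
  array {k} c (toℕ i) (toℕ j) ≡ toℕ (finToFun {k} {k * k} c (combine i j))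
array-toℕ {k} c i j with toℕ i <? k | toℕ j <? k
... | yes p | yes q = cong₂ (λ i j → toℕ (finToFun {k} {k * k} c (combine i j)))
                        (Fin.fromℕ<-toℕ i p) (Fin.fromℕ<-toℕ j q)
... | yes _ | no ¬q = contradiction (Fin.toℕ<n j) ¬q
... | no ¬p | _     = contradiction (Fin.toℕ<n i) ¬p

array-< : ∀ {k} (c : Fin (k ^ (k * k))) {i j} → i < k → j < k → array {k} c i j < k
array-< {k} c {i} {j} i<k j<k with i <? k | j <? k
... | yes p | yes q = Fin.toℕ<n (finToFun {k} {k * k} c (combine (fromℕ< p) (fromℕ< q)))
... | yes _ | no ¬q = contradiction j<k ¬q
... | no ¬p | _     = contradiction i<k ¬p

array-injective : ∀ {k} (c d : Fin (k ^ (k * k))) →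
  (∀ {i j} → i < k → j < k → array {k} c i j ≡ array {k} d i j) → c ≡ d
array-injective {k} c d same = finToFun-injective {k} {k * k} c d λ s →
  case Fin.combine-surjective {k} {k} s of λ { (i , j , refl) → Fin.toℕ-injective
    (trans (sym (array-toℕ {k} c i j)) (trans (same (Fin.toℕ<n i) (Fin.toℕ<n j)) (array-toℕ {k} d i j))) }

countGood-lower : ∀ n k → 5 * k ≤ n → k ^ (k * k) ≤ countGood n
countGood-lower n k 5k≤n = ≤length-by-injection
  (λ c → graph n k (greedy (array {k} c)))
  (λ c → ∈.∈-filter⁺ (T? ∘ isGood) (filter∈sublists _ (triples n)) (graph-good n k (greedy-latin (array {k} c))))
  (λ {c} {d} e → array-injective {k} c d (greedy-determines (array {k} c) (array {k} d) λ i<k j<k →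
    graph-determines 5k≤n e i<k j<k (greedy-< (array {k} c) (array-< {k} c i<k j<k) i<k j<k)))

-- The constants

-- The remainder is below 5, and `5 ≤ n` makes the quotient at least 1, so a second copy of
-- `n / 5 * 5` covers it.
n≤10*[n/5] : ∀ n → 5 ≤ n → n ≤ 10 * (n / 5)
n≤10*[n/5] n 5≤n = begin
  n                    ≡⟨ m≡m%n+[m/n]*n n 5 ⟩
  n % 5 + n / 5 * 5    ≤⟨ ℕ.+-monoˡ-≤ (n / 5 * 5) (ℕ.<⇒≤ (m%n<n n 5)) ⟩
  1 * 5 + n / 5 * 5    ≤⟨ ℕ.+-monoˡ-≤ (n / 5 * 5) (ℕ.*-monoˡ-≤ 5 (/-monoˡ-≤ 5 5≤n)) ⟩
  n / 5 * 5 + n / 5 * 5  ≡⟨ ℕ.*-distribˡ-+ (n / 5) 5 5 ⟨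
  n / 5 * 10           ≡⟨ ℕ.*-comm (n / 5) 10 ⟩
  10 * (n / 5)         ∎
  where open ℕ.≤-Reasoning

-- Let k be `n / 5`. The bound 50 gives `10 ≤ k`, so the base `n` is at most `10 * k`, hence at most
-- `k * k`, and the exponent `n * n` is at most 100 k². Squaring the base doubles 100 to the 200 of
-- the statement.
countGood-lower-power : ∀ n → 50 ≤ n → n ^ (1 * (n * n)) ≤ countGood n ^ 200
countGood-lower-power n@(suc _) 50≤n = begin
  n ^ (1 * (n * n))                 ≡⟨ cong (n ^_) (ℕ.*-identityˡ (n * n)) ⟩
  n ^ (n * n)                       ≤⟨ ℕ.^-monoʳ-≤ n (ℕ.*-mono-≤ n≤10k n≤10k) ⟩
  n ^ (10 * k * (10 * k))           ≤⟨ ℕ.^-monoˡ-≤ (10 * k * (10 * k)) (ℕ.≤-trans n≤10k (ℕ.*-monoˡ-≤ k 10≤k)) ⟩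
  (k * k) ^ (10 * k * (10 * k))     ≡⟨ cong (λ m → (k * m) ^ (10 * k * (10 * k))) (ℕ.*-identityʳ k) ⟨
  (k ^ 2) ^ (10 * k * (10 * k))     ≡⟨ ℕ.^-*-assoc k 2 (10 * k * (10 * k)) ⟩
  k ^ (2 * (10 * k * (10 * k)))     ≡⟨ cong (k ^_) (solve 1 (λ x → con 2 :* (con 10 :* x :* (con 10 :* x))
                                         := x :* x :* con 200) refl k) ⟩
  k ^ (k * k * 200)                 ≡⟨ ℕ.^-*-assoc k (k * k) 200 ⟨
  (k ^ (k * k)) ^ 200               ≤⟨ ℕ.^-monoˡ-≤ 200 (countGood-lower n k 5k≤n) ⟩
  countGood n ^ 200                 ∎
  where
  open ℕ.≤-Reasoning
  open +-*-Solver
  k = n / 5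
  n≤10k : n ≤ 10 * k
  n≤10k = n≤10*[n/5] n (ℕ.≤-trans (ℕ.m≤n+m 5 45) 50≤n)
  10≤k : 10 ≤ k
  10≤k = /-monoˡ-≤ 5 50≤n
  5k≤n : 5 * k ≤ n
  5k≤n = subst (_≤ n) (ℕ.*-comm k 5) (m/n*n≤m n 5)

-- As `n ^ m` is 2 to the power m log n, the bounds place the logarithm of `countGood n` between
-- (p/q) n² log n and C n² log n; the power `q` expresses the rational constant p/q in natural
-- numbers.
theorem1p2 : Σ ℕ λ p → Σ ℕ λ q → Σ ℕ λ C → Σ ℕ λ N →
    (1 ≤ p) × (1 ≤ q) ×
    ((n : ℕ) → N ≤ n →
    (n ^ (p * (n * n)) ≤ countGood n ^ q) × (countGood n ≤ n ^ (C * (n * n))))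
theorem1p2 = 1 , 200 , 2 , 50 , s≤s z≤n , s≤s z≤n , λ n 50≤n →
  countGood-lower-power n 50≤n , countGood-upper n (ℕ.≤-trans (ℕ.m≤n+m 2 48) 50≤n)
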